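{- Let $k$ be an integer and let $G$ be a finite graph with $\operatorname{mad}(G) < 2k$, and write $\Delta = \Delta(G)$. Then $G^2$ is $f(k,\Delta)$-degenerate, where \[ f(k,\Delta)=\max\left\{(2k-1)\Delta-k^2+k,\ (2k-2)\Delta+2k^3+k^2+1,\ (k-1)\Delta+k^4+2k^3+1\right\}. \]
   Context: For a graph $G$, $\Delta(G)$ denotes its maximum degree. The maximum average degree is $\operatorname{mad}(G)=\max\{2|E(H)|/|V(H)| : H \subseteq G\}$, the maximum over (nonempty) subgraphs $H$ of $G$. The square $G^2$ of $G$ is the graph on vertex set $V(G)$ in which two distinct vertices are adjacent if and only if their distance in $G$ is at most $2$. A graph is $d$-degenerate if every nonempty subgraph has a vertex of degree at most $d$ (equivalently, its vertices can be ordered so that each vertex has at most $d$ neighbors preceding it). -}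

module Defs where

open import Data.Bool using (Bool; true; false; if_then_else_; _∧_; _∨_; not)
open import Data.Nat using (ℕ; _⊔_)
open import Data.Fin using (Fin; _≟_)
open import Data.List using (List; map; foldr; allFin)
open import Data.Nat.ListAction using (sum)
open import Data.Bool.ListAction using (any)
open import Data.Product using (Σ; _×_; ∃-syntax)
open import Data.Integer as ℤ using (ℤ; +_)
open import Relation.Binary.PropositionalEquality using (_≡_)
open import Relation.Nullary.Decidable using (⌊_⌋)

count : {n : ℕ} → (Fin n → Bool) → ℕ
count {n} p = sum (map (λ i → if p i then 1 else 0) (allFin n))

record Graph (n : ℕ) : Set where
  field
    adj    : Fin n → Fin n → Bool
    sym    : ∀ u v → adj u v ≡ adj v u
    irrefl : ∀ u → adj u u ≡ false
open Graph public

degIn : {n : ℕ} → (Fin n → Fin n → Bool) → Fin n → ℕ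
degIn a u = count (a u)

Δ : {n : ℕ} → Graph n → ℕ
Δ {n} G = foldr _⊔_ 0 (map (degIn (adj G)) (allFin n))

record Subgraph {n : ℕ} (a : Fin n → Fin n → Bool) : Set where
  field
    vert    : Fin n → Bool
    edge    : Fin n → Fin n → Bool
    edgeSym : ∀ u v → edge u v ≡ edge v u
    edge⊆   : ∀ u v → edge u v ≡ true → a u v ≡ true
    edgeV   : ∀ u v → edge u v ≡ true → vert u ≡ true
open Subgraph public

∣V∣ : {n : ℕ} {a : Fin n → Fin n → Bool} → Subgraph a → ℕ
∣V∣ H = count (vert H)

twice∣E∣ : {n : ℕ} {a : Fin n → Fin n → Bool} → Subgraph a → ℕ
twice∣E∣ {n} H = sum (map (degIn (edge H)) (allFin n))

Nonempty : {n : ℕ} {a : Fin n → Fin n → Bool} → Subgraph a → Set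
Nonempty H = ∃[ v ] (vert H v ≡ true)

-- mad(G) < 2k  :⇔  every nonempty subgraph H has 2|E(H)|/|V(H)| < 2k,
-- i.e. 2|E(H)| < 2k·|V(H)| (|V(H)| > 0).  k is an integer.
madLessThan2k : {n : ℕ} → Graph n → ℤ → Set
madLessThan2k G k = (H : Subgraph (adj G)) → Nonempty H →
  (+ twice∣E∣ H) ℤ.< (+ 2) ℤ.* k ℤ.* (+ ∣V∣ H)

sqAdj : {n : ℕ} → Graph n → Fin n → Fin n → Bool
sqAdj {n} G u v =
  not ⌊ u ≟ v ⌋ ∧ (adj G u v ∨ any (λ w → adj G u w ∧ adj G w v) (allFin n))

Degenerate : {n : ℕ} → (Fin n → Fin n → Bool) → ℤ → Set
Degenerate a d = (H : Subgraph a) → Nonempty H →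
  ∃[ v ] (vert H v ≡ true × (+ degIn (edge H) v) ℤ.≤ d)

f : ℤ → ℕ → ℤ
f k D = ((+ 2) ℤ.* k ℤ.- + 1) ℤ.* + D ℤ.- k ℤ.* k ℤ.+ k
    ℤ.⊔ (((+ 2) ℤ.* k ℤ.- + 2) ℤ.* + D ℤ.+ (+ 2) ℤ.* (k ℤ.* k ℤ.* k) ℤ.+ k ℤ.* k ℤ.+ + 1)
    ℤ.⊔ ((k ℤ.- + 1) ℤ.* + D ℤ.+ k ℤ.* k ℤ.* k ℤ.* k ℤ.+ (+ 2) ℤ.* (k ℤ.* k ℤ.* k) ℤ.+ + 1)

{-# OPTIONS --safe #-}
module Submission where

-- Let S be the vertex set of a subgraph of G² and d(w) the number of neighbours of w in S. A vertex
-- v of S has at most Σ (d(w) − [w ∉ S]) neighbours in S at distance at most 2, summed over its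
-- neighbours w. A vertex outside S with d(w) ≤ k therefore contributes at most k − 1; let the core
-- consist of S and of the remaining vertices. Apply mad < 2k to the core with only the edges that
-- meet S: each edge is worth 2Q, where Q = k(k+1), and every core vertex should keep 2kQ. A core
-- vertex w has 2Q − 2kQ/d(w) to offer per edge (rounded down to four tiers), so some v in S has core
-- neighbours whose offers total less than 2kQ. If none of these has d(w) ≥ kQ, the offers bound the
-- contributions by k⁴ + 2k³ + 1 beyond (k−1)Δ; with between 1 and k − 1 of them, the second term
-- results; with k of them the offers leave no room for a further core neighbour, which is the first
-- term.

open import Defs hiding (sym)
open import Data.Nat using (ℕ)
open import Data.Integer using (ℤ)

open import Data.Bool using (Bool; true; false; if_then_else_; _∧_; _∨_; not)
open import Data.Bool.ListAction using (any)
open import Data.Bool.Properties using (T-≡; ∧-comm; ∨-comm)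
open import Data.Fin using (Fin) renaming (_≟_ to _≟ᶠ_)
open import Data.Integer as ℤ using (+_; -[1+_])
import Data.Integer.Properties as ℤ
import Data.Integer.Tactic.RingSolver as ℤ-Solver
open import Data.List using (List; []; _∷_; map; foldr; allFin)
open import Data.List.Membership.Propositional using (_∈_)
open import Data.List.Membership.Propositional.Properties using (∈-allFin)
open import Data.List.Relation.Unary.Any using (here; there)
open import Data.Nat
open import Data.Nat.ListAction using (sum)
open import Data.Nat.Properties
open import Data.Nat.Tactic.RingSolver using (solve-∀)
open import Data.Product using (∃; ∃₂; _,_; _×_; proj₁; proj₂)
open import Function using (_∘_; Equivalence)
open import Relation.Binary.PropositionalEquality
  using (_≡_; refl; sym; trans; cong; cong₂; subst; subst₂; module ≡-Reasoning)
open import Relation.Nullary using (Dec; yes; no; contradiction)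
open import Relation.Nullary.Decidable using (⌊_⌋)

-- Inequalities with explicit slack, and finite sums.

≤-by : ∀ {m n} o → n ≡ m + o → m ≤ n
≤-by {m} o refl = m≤m+n m o

-- Together with `≤-by`, this reduces an inequality valid from a threshold on to a polynomial
-- identity: `d` becomes the threshold plus `x`, and the slack is exhibited.
∀≥ : ∀ {m d} (R : ℕ → Set) → m ≤ d → (∀ x → R (m + x)) → R d
∀≥ R m≤d h = subst R (m+[n∸m]≡n m≤d) (h _)

⟦_⟧ : Bool → ℕ
⟦ b ⟧ = if b then 1 else 0

module _ {A : Set} where
  sumMap : List A → (A → ℕ) → ℕ
  sumMap xs f = sum (map f xs)

  sumMap-mono : ∀ xs {f g : A → ℕ} → (∀ x → f x ≤ g x) → sumMap xs f ≤ sumMap xs g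
  sumMap-mono []       f≤g = z≤n
  sumMap-mono (x ∷ xs) f≤g = +-mono-≤ (f≤g x) (sumMap-mono xs f≤g)

  sumMap-cong : ∀ xs {f g : A → ℕ} → (∀ x → f x ≡ g x) → sumMap xs f ≡ sumMap xs g
  sumMap-cong xs f≡g = ≤-antisym (sumMap-mono xs (≤-reflexive ∘ f≡g))
                                 (sumMap-mono xs (≤-reflexive ∘ sym ∘ f≡g))

  sumMap-+ : ∀ xs (f g : A → ℕ) → sumMap xs (λ x → f x + g x) ≡ sumMap xs f + sumMap xs g
  sumMap-+ []       f g = refl
  sumMap-+ (x ∷ xs) f g = trans (cong (λ s → f x + g x + s) (sumMap-+ xs f g))
                                (shuffle (f x) (g x) (sumMap xs f) (sumMap xs g))
    where
    shuffle : ∀ a b c d → a + b + (c + d) ≡ a + c + (b + d)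
    shuffle = solve-∀

  sumMap-*ˡ : ∀ xs c (f : A → ℕ) → sumMap xs (λ x → c * f x) ≡ c * sumMap xs f
  sumMap-*ˡ []       c f = sym (*-zeroʳ c)
  sumMap-*ˡ (x ∷ xs) c f = trans (cong (λ s → c * f x + s) (sumMap-*ˡ xs c f))
                                 (sym (*-distribˡ-+ c (f x) (sumMap xs f)))

  sumMap-∈ : ∀ {xs x} (f : A → ℕ) → x ∈ xs → f x ≤ sumMap xs f
  sumMap-∈ f (here refl)          = m≤m+n _ _
  sumMap-∈ f (there {x = y} x∈xs) = m≤n⇒m≤o+n (f y) (sumMap-∈ f x∈xs)

  sumMap-<⇒∃ : ∀ xs {f g : A → ℕ} → sumMap xs f < sumMap xs g → ∃ λ x → f x < g x
  sumMap-<⇒∃ (x ∷ xs) {f} {g} lt with f x <? g x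
  ... | yes fx<gx = x , fx<gx
  ... | no  fx≮gx = sumMap-<⇒∃ xs (≰⇒> λ Σg≤Σf → <⇒≱ lt (+-mono-≤ (≮⇒≥ fx≮gx) Σg≤Σf))

  ⟦any⟧≤sumMap : ∀ xs (p : A → Bool) → ⟦ any p xs ⟧ ≤ sumMap xs (⟦_⟧ ∘ p)
  ⟦any⟧≤sumMap []       p = z≤n
  ⟦any⟧≤sumMap (x ∷ xs) p with p x
  ... | true  = s≤s z≤n
  ... | false = ⟦any⟧≤sumMap xs p

  ∈⇒≤max : ∀ {xs x} (f : A → ℕ) → x ∈ xs → f x ≤ foldr _⊔_ 0 (map f xs)
  ∈⇒≤max f (here refl)          = m≤m⊔n _ _
  ∈⇒≤max f (there {x = y} x∈xs) = m≤n⇒m≤o⊔n (f y) (∈⇒≤max f x∈xs)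

sumMap-swap : ∀ {A B : Set} xs ys (f : A → B → ℕ) →
  sumMap xs (λ x → sumMap ys (f x)) ≡ sumMap ys (λ y → sumMap xs (λ x → f x y))
sumMap-swap []       ys f = sym (sumMap-*ˡ ys 0 (λ _ → 0))
sumMap-swap (x ∷ xs) ys f = trans (cong (λ s → sumMap ys (f x) + s) (sumMap-swap xs ys f))
                                  (sym (sumMap-+ ys (f x) _))

module Summation (n : ℕ) where
  ∑ : (Fin n → ℕ) → ℕ
  ∑ f = sumMap (allFin n) f

  ∑-mono : {f g : Fin n → ℕ} → (∀ i → f i ≤ g i) → ∑ f ≤ ∑ g
  ∑-mono = sumMap-mono (allFin n)

  ∑-cong : {f g : Fin n → ℕ} → (∀ i → f i ≡ g i) → ∑ f ≡ ∑ g
  ∑-cong = sumMap-cong (allFin n)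

  ∑-+ : (f g : Fin n → ℕ) → ∑ (λ i → f i + g i) ≡ ∑ f + ∑ g
  ∑-+ = sumMap-+ (allFin n)

  ∑-*ˡ : ∀ c (f : Fin n → ℕ) → ∑ (λ i → c * f i) ≡ c * ∑ f
  ∑-*ˡ = sumMap-*ˡ (allFin n)

  ∑-swap : (f : Fin n → Fin n → ℕ) → ∑ (λ i → ∑ (f i)) ≡ ∑ (λ i → ∑ (λ l → f l i))
  ∑-swap = sumMap-swap (allFin n) (allFin n)

  term≤∑ : (f : Fin n → ℕ) → ∀ i → f i ≤ ∑ f
  term≤∑ f i = sumMap-∈ f (∈-allFin i)

-- Counting neighbours in the square.

module Neighbours {n : ℕ} (G : Graph n) (H : Subgraph (sqAdj G)) where
  open Summation n

  S : Fin n → Bool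
  S = vert H

  A : Fin n → Fin n → ℕ
  A u v = ⟦ adj G u v ⟧

  σ d : Fin n → ℕ
  σ u = ⟦ S u ⟧
  d u = ∑ λ v → A u v * σ v

  A-sym : ∀ u v → A u v ≡ A v u
  A-sym u v = cong ⟦_⟧ (Graph.sym G u v)

  d≤Δ : ∀ u → d u ≤ Δ G
  d≤Δ u = ≤-trans (∑-mono λ v → ≤-trans (*-monoʳ-≤ (A u v) (⟦⟧≤1 (S v))) (≤-reflexive (*-identityʳ (A u v))))
                  (∈⇒≤max (degIn (adj G)) (∈-allFin u))
    where
    ⟦⟧≤1 : ∀ b → ⟦ b ⟧ ≤ 1
    ⟦⟧≤1 true  = ≤-refl
    ⟦⟧≤1 false = z≤n

  -- Both sides count the pairs of a `v` in `S` and a neighbour `w`, with weight `h w`. Amounts sent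
  -- along edges into `S` can thus be summed at the receiver or at the sender.
  double-count : ∀ (h : Fin n → ℕ) → ∑ (λ v → σ v * ∑ (λ w → A v w * h w)) ≡ ∑ (λ w → h w * d w)
  double-count h = begin
    ∑ (λ v → σ v * ∑ (λ w → A v w * h w))   ≡⟨ ∑-cong (λ v → sym (∑-*ˡ (σ v) (λ w → A v w * h w))) ⟩
    ∑ (λ v → ∑ (λ w → σ v * (A v w * h w))) ≡⟨ ∑-swap _ ⟩
    ∑ (λ w → ∑ (λ v → σ v * (A v w * h w))) ≡⟨ ∑-cong (λ w → ∑-cong (λ v →
      trans (cong (λ a → σ v * (a * h w)) (A-sym v w)) (shuffle (σ v) (A w v) (h w)))) ⟩
    ∑ (λ w → ∑ (λ v → h w * (A w v * σ v))) ≡⟨ ∑-cong (λ w → ∑-*ˡ (h w) (λ v → A w v * σ v)) ⟩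
    ∑ (λ w → h w * d w)                     ∎
    where
    open ≡-Reasoning
    shuffle : ∀ s a x → s * (a * x) ≡ x * (a * s)
    shuffle = solve-∀

  module _ (v : Fin n) (v∈S : S v ≡ true) where
    ne y : Fin n → ℕ
    ne u = ⟦ not ⌊ v ≟ᶠ u ⌋ ⟧
    y w = ∑ λ u → A w u * (σ u * ne u)

    -- The vertex `v` is itself a neighbour of `w` in `S`, counted by `d w` and excluded from `y w`.
    -- This is the 1 saved at a neighbour outside `S`; inside `S` it pays for `w` itself.
    y<d : ∀ w → adj G v w ≡ true → y w < d w
    y<d w v~w = begin-strict
      y w     <⟨ ≤-reflexive (+-comm 1 (y w)) ⟩
      y w + 1 ≤⟨ +-monoʳ-≤ (y w) (≤-trans 1≤ (term≤∑ at-v v)) ⟩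
      y w + ∑ at-v ≡⟨ sym (∑-+ _ at-v) ⟩
      ∑ (λ u → A w u * (σ u * ne u) + at-v u) ≡⟨ ∑-cong (λ u → split (A w u) (σ u) ⌊ v ≟ᶠ u ⌋) ⟩
      d w ∎
      where
      open ≤-Reasoning
      at-v : Fin n → ℕ
      at-v u = A w u * (σ u * ⟦ ⌊ v ≟ᶠ u ⌋ ⟧)
      1≤ : 1 ≤ at-v v
      1≤ rewrite Graph.sym G w v | v~w | v∈S with v ≟ᶠ v
      ... | yes _  = ≤-refl
      ... | no v≢v = contradiction refl v≢v
      split : ∀ a s b → a * (s * ⟦ not b ⟧) + a * (s * ⟦ b ⟧) ≡ a * s
      split a s true  = eq a s
        where
        eq : ∀ a s → a * (s * 0) + a * (s * 1) ≡ a * s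
        eq = solve-∀
      split a s false = eq a s
        where
        eq : ∀ a s → a * (s * 1) + a * (s * 0) ≡ a * s
        eq = solve-∀

    -- A neighbour in the square is reached directly or through a middle vertex `w`; several middle
    -- vertices only enlarge the sum.
    edge-bound : ∀ u → ⟦ edge H v u ⟧ ≤ A v u * σ u + ∑ (λ w → A v w * (A w u * (σ u * ne u)))
    edge-bound u with edge H v u in e
    ... | false = z≤n
    ... | true  = go (edge⊆ H v u e) (edgeV H u v (trans (edgeSym H u v) e))
      where
      go : sqAdj G v u ≡ true → S u ≡ true →
        1 ≤ A v u * σ u + ∑ (λ w → A v w * (A w u * (σ u * ne u)))
      go vu∈G² u∈S rewrite u∈S with ⌊ v ≟ᶠ u ⌋ | adj G v u
      ... | false | true  = s≤s z≤n
      ... | false | false = begin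
        1 ≡⟨ cong ⟦_⟧ (sym vu∈G²) ⟩
        ⟦ any (λ w → adj G v w ∧ adj G w u) (allFin n) ⟧ ≤⟨ ⟦any⟧≤sumMap (allFin n) _ ⟩
        ∑ (λ w → ⟦ adj G v w ∧ adj G w u ⟧) ≡⟨ ∑-cong (λ w → ⟦∧⟧ (adj G v w) (adj G w u)) ⟩
        ∑ (λ w → A v w * (A w u * 1)) ∎
        where
        open ≤-Reasoning
        ⟦∧⟧ : ∀ a b → ⟦ a ∧ b ⟧ ≡ ⟦ a ⟧ * (⟦ b ⟧ * 1)
        ⟦∧⟧ true  true  = refl
        ⟦∧⟧ true  false = refl
        ⟦∧⟧ false _     = refl
      go () _ | true | _

    degree-bound : degIn (edge H) v ≤ ∑ (λ w → A v w * (σ w + y w))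
    degree-bound = begin
      degIn (edge H) v ≤⟨ ∑-mono edge-bound ⟩
      ∑ (λ u → A v u * σ u + ∑ (λ w → A v w * (A w u * (σ u * ne u)))) ≡⟨ ∑-+ _ _ ⟩
      d v + ∑ (λ u → ∑ (λ w → A v w * (A w u * (σ u * ne u))))
        ≡⟨ cong (λ s → d v + s) (trans (∑-swap _) (∑-cong λ w → ∑-*ˡ (A v w) _)) ⟩
      d v + ∑ (λ w → A v w * y w) ≡⟨ sym (∑-+ _ _) ⟩
      ∑ (λ w → A v w * σ w + A v w * y w) ≡⟨ ∑-cong (λ w → sym (*-distribˡ-+ (A v w) (σ w) (y w))) ⟩
      ∑ (λ w → A v w * (σ w + y w)) ∎
      where open ≤-Reasoning

-- Discharging on the core.

module Discharging {n : ℕ} (G : Graph n) (H : Subgraph (sqAdj G)) (k Q : ℕ) (k<Q : k < Q) (rate : ℕ → ℕ)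
  (rate≤Q : ∀ {d} → d < Q → rate d ≤ Q)
  (Q≤rate : ∀ {d} → Q ≤ d → Q ≤ rate d)
  (rate-charge : ∀ {d} → k < d → d * rate d + 2 * (k * Q) ≤ 2 * Q * d) where
  open Summation n
  open Neighbours G H

  heavy core : Fin n → Bool
  heavy w = k <ᵇ d w
  core w = S w ∨ heavy w

  baseCharge : ∀ {d} → Dec (d < Q) → ℕ
  baseCharge {d} (yes _) = Q * d
  baseCharge     (no _)  = 2 * (k * Q)

  -- An edge inside `S` starts with `Q` at each end, an edge leaving `S` with all of its `2 * Q` at
  -- the outer end. A core vertex is to yield `cost w` per edge, so a sender in `S` adds only
  -- `cost w ∸ Q` to the `Q` already at the other end, while an outer one sends `cost w`. This
  -- amount is `φ w`, and `base` is what a vertex of `S` is sure to keep.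
  ω γ cost φ base : Fin n → ℕ
  ω w = ⟦ not (S w) ∧ heavy w ⟧
  γ w = ⟦ core w ⟧
  cost w = rate (d w)
  φ w = if S w then cost w ∸ Q else cost w
  base v = baseCharge (d v <? Q)

  coreGraph : Subgraph (adj G)
  coreGraph = record
    { vert    = core
    ; edge    = λ u v → adj G u v ∧ (S u ∧ core v ∨ core u ∧ S v)
    ; edgeSym = λ u v → cong₂ _∧_ (Graph.sym G u v) (swap (S u) (core u) (S v) (core v))
    ; edge⊆   = λ u v → proj∧ (adj G u v)
    ; edgeV   = λ u v → endpoint (adj G u v) (S u) (heavy u) (core v) (S v)
    }
    where
    swap : ∀ s c s′ c′ → s ∧ c′ ∨ c ∧ s′ ≡ s′ ∧ c ∨ c′ ∧ s
    swap s c s′ c′ = trans (∨-comm (s ∧ c′) (c ∧ s′)) (cong₂ _∨_ (∧-comm c s′) (∧-comm s c′))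
    proj∧ : ∀ a {b} → a ∧ b ≡ true → a ≡ true
    proj∧ true _ = refl
    endpoint : ∀ a s h c′ s′ → a ∧ (s ∧ c′ ∨ (s ∨ h) ∧ s′) ≡ true → s ∨ h ≡ true
    endpoint true true  h     c′ s′ _ = refl
    endpoint true false true  c′ s′ _ = refl

  γ≡σ+ω : ∀ w → γ w ≡ σ w + ω w
  γ≡σ+ω w = go (S w) (heavy w)
    where
    go : ∀ s h → ⟦ s ∨ h ⟧ ≡ ⟦ s ⟧ + ⟦ not s ∧ h ⟧
    go true  h = refl
    go false h = refl

  ∣V∣-core : ∣V∣ coreGraph ≡ ∑ σ + ∑ ω
  ∣V∣-core = trans (∑-cong γ≡σ+ω) (∑-+ σ ω)

  -- Edges between `S` and the outer core vertices occur in the rows of both ends; `double-count`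
  -- makes the two contributions equal, whence the factor 2.
  twice∣E∣-core : twice∣E∣ coreGraph ≡ ∑ (λ u → σ u * d u + 2 * (ω u * d u))
  twice∣E∣-core = begin
    ∑ (λ u → ∑ (λ v → ⟦ edge coreGraph u v ⟧))
      ≡⟨ ∑-cong row ⟩
    ∑ (λ u → σ u * d u + σ u * ∑ (λ v → A u v * ω v) + ω u * d u)
      ≡⟨ trans (∑-+ _ _) (cong (_+ ∑ (λ u → ω u * d u)) (∑-+ _ _)) ⟩
    ∑ (λ u → σ u * d u) + ∑ (λ u → σ u * ∑ (λ v → A u v * ω v)) + ∑ (λ u → ω u * d u)
      ≡⟨ cong (λ x → ∑ (λ u → σ u * d u) + x + ∑ (λ u → ω u * d u)) (double-count ω) ⟩
    ∑ (λ u → σ u * d u) + ∑ (λ u → ω u * d u) + ∑ (λ u → ω u * d u)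
      ≡⟨ eq (∑ (λ u → σ u * d u)) (∑ (λ u → ω u * d u)) ⟩
    ∑ (λ u → σ u * d u) + 2 * ∑ (λ u → ω u * d u)
      ≡⟨ cong (λ s → ∑ (λ u → σ u * d u) + s) (sym (∑-*ˡ 2 _)) ⟩
    ∑ (λ u → σ u * d u) + ∑ (λ u → 2 * (ω u * d u))
      ≡⟨ sym (∑-+ _ _) ⟩
    ∑ (λ u → σ u * d u + 2 * (ω u * d u)) ∎
    where
    open ≡-Reasoning
    eq : ∀ x y → x + y + y ≡ x + 2 * y
    eq = solve-∀
    entry : ∀ a s h s′ h′ → ⟦ a ∧ (s ∧ (s′ ∨ h′) ∨ (s ∨ h) ∧ s′) ⟧ ≡
      ⟦ s ⟧ * (⟦ a ⟧ * ⟦ s′ ⟧) + ⟦ s ⟧ * (⟦ a ⟧ * ⟦ not s′ ∧ h′ ⟧) + ⟦ not s ∧ h ⟧ * (⟦ a ⟧ * ⟦ s′ ⟧)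
    entry false true  h     s′    h′    = refl
    entry false false true  s′    h′    = refl
    entry false false false s′    h′    = refl
    entry true  true  h     true  h′    = refl
    entry true  true  h     false true  = refl
    entry true  true  h     false false = refl
    entry true  false true  true  h′    = refl
    entry true  false false true  h′    = refl
    entry true  false true  false h′    = refl
    entry true  false false false h′    = refl
    row : ∀ u → ∑ (λ v → ⟦ edge coreGraph u v ⟧) ≡
      σ u * d u + σ u * ∑ (λ v → A u v * ω v) + ω u * d u
    row u = begin
      ∑ (λ v → ⟦ edge coreGraph u v ⟧)
        ≡⟨ ∑-cong (λ v → entry (adj G u v) (S u) (heavy u) (S v) (heavy v)) ⟩
      ∑ (λ v → σ u * (A u v * σ v) + σ u * (A u v * ω v) + ω u * (A u v * σ v))
        ≡⟨ trans (∑-+ _ _) (cong (_+ ∑ (λ v → ω u * (A u v * σ v))) (∑-+ _ _)) ⟩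
      ∑ (λ v → σ u * (A u v * σ v)) + ∑ (λ v → σ u * (A u v * ω v)) + ∑ (λ v → ω u * (A u v * σ v))
        ≡⟨ cong₂ _+_ (cong₂ _+_ (∑-*ˡ (σ u) _) (∑-*ˡ (σ u) _)) (∑-*ˡ (ω u) _) ⟩
      σ u * d u + σ u * ∑ (λ v → A u v * ω v) + ω u * d u ∎

  -- A vertex of S with at least Q neighbours in S gives away all of its charge beyond 2 * (k * Q),
  -- one with fewer gives nothing.
  base+φ≤ : ∀ {d} → (q : Dec (d < Q)) → baseCharge q + (rate d ∸ Q) * d ≤ Q * d
  base+φ≤ {d} (yes d<Q) = ≤-reflexive
    (trans (cong (λ x → Q * d + x * d) (m≤n⇒m∸n≡0 (rate≤Q d<Q))) (+-identityʳ (Q * d)))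
  base+φ≤ {d} (no d≮Q)  = +-cancelʳ-≤ (d * Q) _ _ (begin
    2 * (k * Q) + (rate d ∸ Q) * d + d * Q ≡⟨ eq₁ (2 * (k * Q)) (rate d ∸ Q) d Q ⟩
    d * (rate d ∸ Q + Q) + 2 * (k * Q)     ≡⟨ cong (λ x → d * x + 2 * (k * Q)) (m∸n+n≡m (Q≤rate Q≤d)) ⟩
    d * rate d + 2 * (k * Q)               ≤⟨ rate-charge (<-≤-trans k<Q Q≤d) ⟩
    2 * Q * d                              ≡⟨ eq₂ Q d ⟩
    Q * d + d * Q                          ∎)
    where
    open ≤-Reasoning
    Q≤d = ≮⇒≥ d≮Q
    eq₁ : ∀ b x d q → b + x * d + d * q ≡ d * (x + q) + b
    eq₁ = solve-∀
    eq₂ : ∀ q d → 2 * q * d ≡ q * d + d * q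
    eq₂ = solve-∀

  -- The right side is the initial charge of `w`, the left side what it keeps plus what it sends.
  -- For outer core vertices this is `rate-charge`, for vertices of `S` it is `base+φ≤`.
  charge : ∀ w → σ w * base w + γ w * φ w * d w + 2 * (k * Q) * ω w ≤ Q * (σ w * d w + 2 * (ω w * d w))
  charge w = go (S w) (heavy w) (<ᵇ⇒< k (d w) ∘ Equivalence.from T-≡)
    where
    open ≤-Reasoning
    go : ∀ s h → (h ≡ true → k < d w) →
      ⟦ s ⟧ * base w + ⟦ s ∨ h ⟧ * (if s then cost w ∸ Q else cost w) * d w + 2 * (k * Q) * ⟦ not s ∧ h ⟧ ≤
      Q * (⟦ s ⟧ * d w + 2 * (⟦ not s ∧ h ⟧ * d w))
    go true h _ = begin
      1 * base w + 1 * (cost w ∸ Q) * d w + 2 * (k * Q) * 0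
        ≡⟨ eq₁ (base w) (cost w ∸ Q) (d w) (2 * (k * Q)) ⟩
      base w + (cost w ∸ Q) * d w ≤⟨ base+φ≤ (d w <? Q) ⟩
      Q * d w                     ≡⟨ eq₂ Q (d w) ⟩
      Q * (1 * d w + 2 * (0 * d w)) ∎
      where
      eq₁ : ∀ b x d c → 1 * b + 1 * x * d + c * 0 ≡ b + x * d
      eq₁ = solve-∀
      eq₂ : ∀ q d → q * d ≡ q * (1 * d + 2 * (0 * d))
      eq₂ = solve-∀
    go false true k<d = begin
      0 * base w + 1 * cost w * d w + 2 * (k * Q) * 1 ≡⟨ eq₁ (cost w) (d w) (2 * (k * Q)) ⟩
      d w * cost w + 2 * (k * Q)                      ≤⟨ rate-charge (k<d refl) ⟩
      2 * Q * d w                                     ≡⟨ eq₂ Q (d w) ⟩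
      Q * (0 * d w + 2 * (1 * d w))                   ∎
      where
      eq₁ : ∀ x d c → 1 * x * d + c * 1 ≡ d * x + c
      eq₁ = solve-∀
      eq₂ : ∀ q d → 2 * q * d ≡ q * (0 * d + 2 * (1 * d))
      eq₂ = solve-∀
    go false false _ = ≤-trans (≤-reflexive (*-zeroʳ (2 * (k * Q)))) z≤n

  module _ (sparse : twice∣E∣ coreGraph < 2 * k * ∣V∣ coreGraph) where

    total : Fin n → ℕ
    total v = base v + ∑ (λ w → A v w * (γ w * φ w))

    -- Summing `charge` and moving the sent amounts to their receivers leaves `2 * (k * Q)` at each
    -- outer core vertex. That cancels against its share of the bound from `sparse`, so the shortage
    -- falls on `S`.
    total-< : ∑ (λ v → σ v * total v) < ∑ (λ v → σ v * (2 * (k * Q)))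
    total-< = +-cancelʳ-< (2 * (k * Q) * ∑ ω) _ _ (begin-strict
      ∑ (λ v → σ v * total v) + 2 * (k * Q) * ∑ ω
        ≡⟨ cong (_+ 2 * (k * Q) * ∑ ω) (trans (∑-cong λ v → *-distribˡ-+ (σ v) (base v) _) (∑-+ _ _)) ⟩
      ∑ (λ v → σ v * base v) + ∑ (λ v → σ v * ∑ (λ w → A v w * (γ w * φ w))) + 2 * (k * Q) * ∑ ω
        ≡⟨ cong₂ (λ x y → ∑ (λ v → σ v * base v) + x + y) (double-count (λ w → γ w * φ w))
             (sym (∑-*ˡ (2 * (k * Q)) ω)) ⟩
      ∑ (λ v → σ v * base v) + ∑ (λ w → γ w * φ w * d w) + ∑ (λ w → 2 * (k * Q) * ω w)
        ≡⟨ cong (_+ ∑ (λ w → 2 * (k * Q) * ω w)) (sym (∑-+ _ _)) ⟩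
      ∑ (λ w → σ w * base w + γ w * φ w * d w) + ∑ (λ w → 2 * (k * Q) * ω w)
        ≡⟨ sym (∑-+ _ _) ⟩
      ∑ (λ w → σ w * base w + γ w * φ w * d w + 2 * (k * Q) * ω w)
        ≤⟨ ∑-mono charge ⟩
      ∑ (λ w → Q * (σ w * d w + 2 * (ω w * d w)))
        ≡⟨ trans (∑-*ˡ Q _) (cong (Q *_) (sym twice∣E∣-core)) ⟩
      Q * twice∣E∣ coreGraph
        <⟨ *-monoʳ-< Q ⦃ >-nonZero (≤-<-trans z≤n k<Q) ⦄ sparse ⟩
      Q * (2 * k * ∣V∣ coreGraph)
        ≡⟨ cong (λ x → Q * (2 * k * x)) ∣V∣-core ⟩
      Q * (2 * k * (∑ σ + ∑ ω))
        ≡⟨ eq Q k (∑ σ) (∑ ω) ⟩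
      2 * (k * Q) * ∑ σ + 2 * (k * Q) * ∑ ω
        ≡⟨ cong (_+ 2 * (k * Q) * ∑ ω)
             (trans (sym (∑-*ˡ (2 * (k * Q)) σ)) (∑-cong λ v → *-comm (2 * (k * Q)) (σ v))) ⟩
      ∑ (λ v → σ v * (2 * (k * Q))) + 2 * (k * Q) * ∑ ω ∎)
      where
      open ≤-Reasoning
      eq : ∀ q k x y → q * (2 * k * (x + y)) ≡ 2 * (k * q) * x + 2 * (k * q) * y
      eq = solve-∀

    -- A vertex of `S` with at least `Q` neighbours in `S` already keeps `2 * (k * Q)`, so the
    -- deficient one has fewer and keeps `Q` for each of them. This `Q` completes `cost w ∸ Q` to at
    -- least `cost w`.
    cheap-vertex : ∃ λ v → S v ≡ true × ∑ (λ w → A v w * γ w * cost w) < 2 * (k * Q)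
    cheap-vertex =
      let v , σv*total<   = sumMap-<⇒∃ (allFin n) total-<
          v∈S , total<2kQ = selected (S v) σv*total<
      in v , v∈S , ≤-<-trans (cost≤total v total<2kQ) total<2kQ
      where
      selected : ∀ {x} s → ⟦ s ⟧ * x < ⟦ s ⟧ * (2 * (k * Q)) → s ≡ true × x < 2 * (k * Q)
      selected {x} true lt = refl , subst₂ _<_ (*-identityˡ x) (*-identityˡ (2 * (k * Q))) lt
      base≡ : ∀ {d x} (q : Dec (d < Q)) → baseCharge q + x < 2 * (k * Q) → baseCharge q ≡ Q * d
      base≡ (yes _) _  = refl
      base≡ (no _)  lt = contradiction lt (m+n≮m (2 * (k * Q)) _)
      pointwise : ∀ a s h t → a * ⟦ s ∨ h ⟧ * t ≤
        Q * (a * ⟦ s ⟧) + a * (⟦ s ∨ h ⟧ * (if s then t ∸ Q else t))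
      pointwise a true h t = begin
        a * 1 * t                       ≤⟨ *-monoʳ-≤ (a * 1) (m≤n+m∸n t Q) ⟩
        a * 1 * (Q + (t ∸ Q))           ≡⟨ eq a Q (t ∸ Q) ⟩
        Q * (a * 1) + a * (1 * (t ∸ Q)) ∎
        where
        open ≤-Reasoning
        eq : ∀ a q x → a * 1 * (q + x) ≡ q * (a * 1) + a * (1 * x)
        eq = solve-∀
      pointwise a false h t = ≤-trans (≤-reflexive (*-assoc a ⟦ h ⟧ t)) (m≤n+m _ (Q * (a * 0)))
      cost≤total : ∀ v → total v < 2 * (k * Q) → ∑ (λ w → A v w * γ w * cost w) ≤ total v
      cost≤total v total<2kQ = begin
        ∑ (λ w → A v w * γ w * cost w)
          ≤⟨ ∑-mono (λ w → pointwise (A v w) (S w) (heavy w) (cost w)) ⟩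
        ∑ (λ w → Q * (A v w * σ w) + A v w * (γ w * φ w))
          ≡⟨ trans (∑-+ _ _) (cong (_+ ∑ (λ w → A v w * (γ w * φ w))) (∑-*ˡ Q _)) ⟩
        Q * d v + ∑ (λ w → A v w * (γ w * φ w))
          ≡⟨ cong (_+ ∑ (λ w → A v w * (γ w * φ w))) (sym (base≡ (d v <? Q) total<2kQ)) ⟩
        total v ∎
        where open ≤-Reasoning

-- The four tiers of offers.

module Cost (j : ℕ) where
  -- With k = j + 1, Q is k (k + 1) and P is Q − 2, so that no subtraction is needed below.
  k P Q K B : ℕ
  k = suc j
  P = j * (j + 3)
  Q = 2 + P
  K = k * k * k
  B = k * Q

  -- The cost is at most 2 Q − 2 B / d, the amount that a core vertex with d neighbours in S can offer.
  data Tier (d : ℕ) : (cost big : ℕ) → Set where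
    tier₀ : d < Q → d < B → Tier d (2 * k) 0
    tier₁ : Q ≤ d → d < K → d < B → Tier d (2 * (k * k)) 0
    tier₂ : Q ≤ d → K ≤ d → d < B → Tier d (2 * P) 0
    tier₃ : Q ≤ d → B ≤ d → Tier d (2 * (1 + P)) 1

  Q≤B : Q ≤ B
  Q≤B = m≤m+n Q (j * Q)

  tier : ∀ d → ∃₂ (Tier d)
  tier d with d <? Q | d <? K | d <? B
  ... | yes d<Q | _       | _       = _ , _ , tier₀ d<Q (≤-trans d<Q Q≤B)
  ... | no d≮Q  | _       | no d≮B  = _ , _ , tier₃ (≮⇒≥ d≮Q) (≮⇒≥ d≮B)
  ... | no d≮Q  | yes d<K | yes d<B = _ , _ , tier₁ (≮⇒≥ d≮Q) d<K d<B
  ... | no d≮Q  | no d≮K  | yes d<B = _ , _ , tier₂ (≮⇒≥ d≮Q) (≮⇒≥ d≮K) d<B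

  -- The exact offer `2 Q − 2 B / d` grows with `d`, so each tier uses its value at the lower end:
  -- `2 k` at `k + 1`, `2 k²` at `Q`, `2 Q − 2` at `B`. At `K` it is `2 Q − 2 − 2 / k`, lowered to
  -- `2 Q − 4`.
  cost-charge₀ : ∀ x → (k + 1 + x) * (2 * k) + 2 * B ≤ 2 * Q * (k + 1 + x)
  cost-charge₀ x = ≤-by (2 * (1 + j) * (1 + j) * x) (eq j x)
    where
    eq : ∀ j x → 2 * (2 + j * (j + 3)) * (1 + j + 1 + x) ≡
      (1 + j + 1 + x) * (2 * (1 + j)) + 2 * ((1 + j) * (2 + j * (j + 3))) + 2 * (1 + j) * (1 + j) * x
    eq = solve-∀

  cost-charge₁ : ∀ x → (Q + x) * (2 * (k * k)) + 2 * B ≤ 2 * Q * (Q + x)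
  cost-charge₁ x = ≤-by (2 * (1 + j) * x) (eq j x)
    where
    eq : ∀ j x → 2 * (2 + j * (j + 3)) * (2 + j * (j + 3) + x) ≡
      (2 + j * (j + 3) + x) * (2 * ((1 + j) * (1 + j))) + 2 * ((1 + j) * (2 + j * (j + 3)))
        + 2 * (1 + j) * x
    eq = solve-∀

  cost-charge₂ : ∀ x → (K + x) * (2 * P) + 2 * B ≤ 2 * Q * (K + x)
  cost-charge₂ x = ≤-by (2 * (1 + j) * (1 + j) * j + 4 * x) (eq j x)
    where
    eq : ∀ j x → 2 * (2 + j * (j + 3)) * ((1 + j) * (1 + j) * (1 + j) + x) ≡
      ((1 + j) * (1 + j) * (1 + j) + x) * (2 * (j * (j + 3))) + 2 * ((1 + j) * (2 + j * (j + 3)))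
        + (2 * (1 + j) * (1 + j) * j + 4 * x)
    eq = solve-∀

  cost-charge₃ : ∀ x → (B + x) * (2 * (1 + P)) + 2 * B ≤ 2 * Q * (B + x)
  cost-charge₃ x = ≤-by (2 * x) (eq j x)
    where
    eq : ∀ j x → 2 * (2 + j * (j + 3)) * ((1 + j) * (2 + j * (j + 3)) + x) ≡
      ((1 + j) * (2 + j * (j + 3)) + x) * (2 * (1 + j * (j + 3))) + 2 * ((1 + j) * (2 + j * (j + 3)))
        + 2 * x
    eq = solve-∀

  cost-charge : ∀ {d c b} → Tier d c b → k < d → d * c + 2 * B ≤ 2 * Q * d
  cost-charge {d} (tier₀ _ _) k<d =
    ∀≥ (λ d → d * (2 * k) + 2 * B ≤ 2 * Q * d) (subst (_≤ d) (sym (+-comm k 1)) k<d) cost-charge₀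
  cost-charge (tier₁ Q≤d _ _) _ = ∀≥ (λ d → d * (2 * (k * k)) + 2 * B ≤ 2 * Q * d) Q≤d cost-charge₁
  cost-charge (tier₂ _ K≤d _) _ = ∀≥ (λ d → d * (2 * P) + 2 * B ≤ 2 * Q * d) K≤d cost-charge₂
  cost-charge (tier₃ _ B≤d)   _ = ∀≥ (λ d → d * (2 * (1 + P)) + 2 * B ≤ 2 * Q * d) B≤d cost-charge₃

  2k≤Q : 2 * k ≤ Q
  2k≤Q = ≤-by (j * j + j) (eq j)
    where
    eq : ∀ j → 2 + j * (j + 3) ≡ 2 * (1 + j) + (j * j + j)
    eq = solve-∀

  k<Q : k < Q
  k<Q = ≤-by (j * (j + 2)) (eq j)
    where
    eq : ∀ j → 2 + j * (j + 3) ≡ 2 + j + j * (j + 2)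
    eq = solve-∀

  -- For j ≡ 0 the third tier is empty, because then Q ≡ B.
  tier₂⇒positive : ∀ {d} → Q ≤ d → d < B → ∃ λ i → j ≡ suc i
  tier₂⇒positive = go j
    where
    go : ∀ j {d} → 2 + j * (j + 3) ≤ d → d < suc j * (2 + j * (j + 3)) → ∃ λ i → j ≡ suc i
    go zero    Q≤d d<B = contradiction Q≤d (<⇒≱ d<B)
    go (suc i) _   _   = i , refl

  Q≤cost : ∀ {d c b} → Tier d c b → Q ≤ d → Q ≤ c
  Q≤cost (tier₀ d<Q _) Q≤d = contradiction Q≤d (<⇒≱ d<Q)
  Q≤cost (tier₁ _ _ _) _ = ≤-by (j * j + j) (eq j)
    where
    eq : ∀ j → 2 * ((1 + j) * (1 + j)) ≡ 2 + j * (j + 3) + (j * j + j)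
    eq = solve-∀
  Q≤cost (tier₂ Q≤d _ d<B) _ with tier₂⇒positive Q≤d d<B
  ... | i , refl = ≤-by (i * i + 5 * i + 2) (eq i)
    where
    eq : ∀ i → 2 * ((1 + i) * (1 + i + 3)) ≡ 2 + (1 + i) * (1 + i + 3) + (i * i + 5 * i + 2)
    eq = solve-∀
  Q≤cost (tier₃ _ _) _ = ≤-by P (eq P)
    where
    eq : ∀ p → 2 * (1 + p) ≡ 2 + p + p
    eq = solve-∀

  cost≤Q : ∀ {d c b} → Tier d c b → d < Q → c ≤ Q
  cost≤Q (tier₀ _ _)     _   = 2k≤Q
  cost≤Q (tier₁ Q≤d _ _) d<Q = contradiction Q≤d (<⇒≱ d<Q)
  cost≤Q (tier₂ Q≤d _ _) d<Q = contradiction Q≤d (<⇒≱ d<Q)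
  cost≤Q (tier₃ Q≤d _)   d<Q = contradiction Q≤d (<⇒≱ d<Q)

  small⇒big≡0 : ∀ {d c b} → Tier d c b → d < B → b ≡ 0
  small⇒big≡0 (tier₀ _ _)   _   = refl
  small⇒big≡0 (tier₁ _ _ _) _   = refl
  small⇒big≡0 (tier₂ _ _ _) _   = refl
  small⇒big≡0 (tier₃ _ B≤d) d<B = contradiction B≤d (<⇒≱ d<B)

  -- Splitting the top cost as `2 k` plus a surplus lets one sum over the core neighbours bound
  -- their number and the number of big ones together.
  cost-lower-bound : ∀ {d c b} → Tier d c b → 2 * k + b * (2 * j * (j + 2)) ≤ c
  cost-lower-bound (tier₀ _ _) = ≤-reflexive (+-identityʳ (2 * k))
  cost-lower-bound t@(tier₁ Q≤d _ _) =
    ≤-trans (≤-reflexive (+-identityʳ (2 * k))) (≤-trans 2k≤Q (Q≤cost t Q≤d))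
  cost-lower-bound t@(tier₂ Q≤d _ _) =
    ≤-trans (≤-reflexive (+-identityʳ (2 * k))) (≤-trans 2k≤Q (Q≤cost t Q≤d))
  cost-lower-bound (tier₃ _ _) = ≤-reflexive (eq j)
    where
    eq : ∀ j → 2 * (1 + j) + 1 * (2 * j * (j + 2)) ≡ 2 * (1 + j * (j + 3))
    eq = solve-∀

  -- Below the top tier the excess of `d` over `j` per unit of cost is at most `(2 k + 1) / 4`: the
  -- first two tiers give at most `k / 2`, and the third attains the bound at `k = 2`. In the top
  -- tier the cost terms cancel and `D ∸ j` bounds the excess.
  excess≤cost : ∀ {d c b D} → Tier d c b → d ≤ D →
    4 * (d ∸ j) + b * ((2 * k + 1) * (2 * (1 + P))) ≤ (2 * k + 1) * c + b * (4 * (D ∸ j))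
  excess≤cost {d} (tier₀ (s≤s d≤) _) _ = +-monoˡ-≤ 0 (≤-trans
      (*-monoʳ-≤ 4 (m≤n+o⇒m∸n≤o d j (≤-trans d≤ (≤-reflexive (eq₁ j)))))
      (≤-by (2 * (1 + j)) (eq₂ j)))
    where
    eq₁ : ∀ j → 1 + j * (j + 3) ≡ j + (1 + j) * (1 + j)
    eq₁ = solve-∀
    eq₂ : ∀ j → (2 * (1 + j) + 1) * (2 * (1 + j)) ≡ 4 * ((1 + j) * (1 + j)) + 2 * (1 + j)
    eq₂ = solve-∀
  excess≤cost {d} (tier₁ _ d<K _) _ = +-monoˡ-≤ 0 (≤-trans
      (*-monoʳ-≤ 4 (≤-trans (m∸n≤m d j) (<⇒≤ d<K)))
      (≤-by (2 * (k * k)) (eq j)))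
    where
    eq : ∀ j → (2 * (1 + j) + 1) * (2 * ((1 + j) * (1 + j))) ≡
      4 * ((1 + j) * (1 + j) * (1 + j)) + 2 * ((1 + j) * (1 + j))
    eq = solve-∀
  excess≤cost {d} (tier₂ Q≤d _ d<B) _ with tier₂⇒positive Q≤d d<B
  ... | i , refl = +-monoˡ-≤ 0 (≤-trans
      (*-monoʳ-≤ 4 (m≤n+o⇒m∸n≤o d j (≤-trans (≤-pred d<B) (≤-reflexive (eq₁ i)))))
      (≤-by (2 * i * i + 6 * i) (eq₂ i)))
    where
    eq₁ : ∀ i → 1 + (1 + i) * (1 + i + 3) + (1 + i) * (2 + (1 + i) * (1 + i + 3)) ≡
      1 + i + (2 + i) * (1 + (1 + i) * (1 + i + 3))
    eq₁ = solve-∀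
    eq₂ : ∀ i → (2 * (2 + i) + 1) * (2 * ((1 + i) * (1 + i + 3))) ≡
      4 * ((2 + i) * (1 + (1 + i) * (1 + i + 3))) + (2 * i * i + 6 * i)
    eq₂ = solve-∀
  excess≤cost {d} {D = D} (tier₃ _ _) d≤D = begin
      4 * (d ∸ j) + 1 * x   ≡⟨ +-comm (4 * (d ∸ j)) (1 * x) ⟩
      1 * x + 4 * (d ∸ j)   ≡⟨ cong₂ _+_ (*-identityˡ x) (sym (*-identityˡ (4 * (d ∸ j)))) ⟩
      x + 1 * (4 * (d ∸ j)) ≤⟨ +-monoʳ-≤ x (*-monoʳ-≤ 1 (*-monoʳ-≤ 4 (∸-monoˡ-≤ j d≤D))) ⟩
      x + 1 * (4 * (D ∸ j)) ∎
    where
    open ≤-Reasoning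
    x = (2 * k + 1) * (2 * (1 + P))

-- Comparison with the three terms of `f`.

pos³ : ∀ a b c → + (a * b * c) ≡ + a ℤ.* + b ℤ.* + c
pos³ a b c = trans (ℤ.pos-* (a * b) c) (cong (ℤ._* + c) (ℤ.pos-* a b))

pos⁴ : ∀ a b c e → + (a * b * c * e) ≡ + a ℤ.* + b ℤ.* + c ℤ.* + e
pos⁴ a b c e = trans (ℤ.pos-* (a * b * c) e) (cong (ℤ._* + e) (pos³ a b c))

module _ (j : ℕ) where
  open Cost j

  pos-2k³ : + (2 * (k * k * k)) ≡ + 2 ℤ.* (+ k ℤ.* + k ℤ.* + k)
  pos-2k³ = trans (ℤ.pos-* 2 (k * k * k)) (cong (+ 2 ℤ.*_) (pos³ k k k))

  -- With `M` in the role of `D − j`, the negative term `− k² + k` is absorbed and the bound can be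
  -- stated over the naturals.
  ≤f-first : ∀ {x} M → x ≤ j * (j + M) + k * M → + x ℤ.≤ f (+ k) (j + M)
  ≤f-first {x} M x≤ = ℤ.≤-trans (ℤ.+≤+ x≤) (ℤ.≤-trans (ℤ.≤-reflexive eq)
    (ℤ.≤-trans (ℤ.i≤i⊔j _ _) (ℤ.i≤i⊔j _ _)))
    where
    poly : ∀ J M → J ℤ.* (J ℤ.+ M) ℤ.+ (+ 1 ℤ.+ J) ℤ.* M ≡
      (+ 2 ℤ.* (+ 1 ℤ.+ J) ℤ.- + 1) ℤ.* (J ℤ.+ M) ℤ.- (+ 1 ℤ.+ J) ℤ.* (+ 1 ℤ.+ J) ℤ.+ (+ 1 ℤ.+ J)
    poly = ℤ-Solver.solve-∀
    eq : + (j * (j + M) + k * M) ≡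
      (+ 2 ℤ.* + k ℤ.- + 1) ℤ.* + (j + M) ℤ.- + k ℤ.* + k ℤ.+ + k
    eq = trans (cong₂ ℤ._+_ (ℤ.pos-* j (j + M)) (ℤ.pos-* k M)) (poly (+ j) (+ M))

  ≤f-second : ∀ {x} D → x ≤ j * D + (j * D + (2 * (k * k * k) + k * k + 1)) → + x ℤ.≤ f (+ k) D
  ≤f-second {x} D x≤ = ℤ.≤-trans (ℤ.+≤+ x≤) (ℤ.≤-trans (ℤ.≤-reflexive eq)
    (ℤ.≤-trans (ℤ.i≤j⊔i _ _) (ℤ.i≤i⊔j _ _)))
    where
    poly : ∀ J D c b → J ℤ.* D ℤ.+ (J ℤ.* D ℤ.+ (c ℤ.+ b ℤ.+ + 1)) ≡
      (+ 2 ℤ.* (+ 1 ℤ.+ J) ℤ.- + 2) ℤ.* D ℤ.+ c ℤ.+ b ℤ.+ + 1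
    poly = ℤ-Solver.solve-∀
    eq : + (j * D + (j * D + (2 * (k * k * k) + k * k + 1))) ≡
      (+ 2 ℤ.* + k ℤ.- + 2) ℤ.* + D ℤ.+ + 2 ℤ.* (+ k ℤ.* + k ℤ.* + k) ℤ.+ + k ℤ.* + k ℤ.+ + 1
    eq = trans (cong₂ (λ x y → x ℤ.+ (x ℤ.+ (y ℤ.+ + k ℤ.* + k ℤ.+ + 1))) (ℤ.pos-* j D) pos-2k³)
               (poly (+ j) (+ D) (+ 2 ℤ.* (+ k ℤ.* + k ℤ.* + k)) (+ k ℤ.* + k))

  ≤f-third : ∀ {x} D → x ≤ j * D + (k * k * k * k + 2 * (k * k * k) + 1) → + x ℤ.≤ f (+ k) D
  ≤f-third {x} D x≤ = ℤ.≤-trans (ℤ.+≤+ x≤) (ℤ.≤-trans (ℤ.≤-reflexive eq) (ℤ.i≤j⊔i _ _))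
    where
    poly : ∀ J D a c → J ℤ.* D ℤ.+ (a ℤ.+ c ℤ.+ + 1) ≡ (+ 1 ℤ.+ J ℤ.- + 1) ℤ.* D ℤ.+ a ℤ.+ c ℤ.+ + 1
    poly = ℤ-Solver.solve-∀
    eq : + (j * D + (k * k * k * k + 2 * (k * k * k) + 1)) ≡
      (+ k ℤ.- + 1) ℤ.* + D ℤ.+ + k ℤ.* + k ℤ.* + k ℤ.* + k ℤ.+ + 2 ℤ.* (+ k ℤ.* + k ℤ.* + k) ℤ.+ + 1
    eq = trans (cong₂ ℤ._+_ (ℤ.pos-* j D) (cong₂ (λ x y → x ℤ.+ y ℤ.+ + 1) (pos⁴ k k k k) pos-2k³))
               (poly (+ j) (+ D) (+ k ℤ.* + k ℤ.* + k ℤ.* + k) (+ 2 ℤ.* (+ k ℤ.* + k ℤ.* + k)))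

  module _ {T : ℕ} (T<2B : T < 2 * B) where

    bound-without-big : ∀ {L} → 4 * L ≤ (2 * k + 1) * T → L ≤ k * k * k * k + 2 * (k * k * k) + 1
    bound-without-big {L} 4L≤ = *-cancelˡ-≤ 4 (begin
      4 * L                                       ≤⟨ 4L≤ ⟩
      (2 * k + 1) * T                             ≤⟨ *-monoʳ-≤ (2 * k + 1) (<⇒≤ T<2B) ⟩
      (2 * k + 1) * (2 * B)                       ≤⟨ ≤-by (2 * (k * k) * j + 4) (eq j) ⟩
      4 * (k * k * k * k + 2 * (k * k * k) + 1)   ∎)
      where
      open ≤-Reasoning
      eq : ∀ j → 4 * ((1 + j) * (1 + j) * (1 + j) * (1 + j) + 2 * ((1 + j) * (1 + j) * (1 + j)) + 1) ≡
        (2 * (1 + j) + 1) * (2 * ((1 + j) * (2 + j * (j + 3)))) + (2 * ((1 + j) * (1 + j)) * j + 4)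
      eq = solve-∀

    -- With `k` big ones among them, `k + 1` core neighbours would cost
    -- `2 k (k + 1) + 2 k (k² − 1)`, which is exactly `2 * B`.
    few-core-neighbours : ∀ {m b} → k ≤ b → 2 * k * m + b * (2 * j * (j + 2)) ≤ T → m ≤ k
    few-core-neighbours {m} {b} k≤b ≤T = ≮⇒≥ λ k<m → <⇒≱ T<2B (begin
      2 * B                                   ≡⟨ eq j ⟩
      2 * k * (1 + k) + k * (2 * j * (j + 2)) ≤⟨ +-mono-≤ (*-monoʳ-≤ (2 * k) k<m) (*-monoˡ-≤ (2 * j * (j + 2)) k≤b) ⟩
      2 * k * m + b * (2 * j * (j + 2))       ≤⟨ ≤T ⟩
      T                                       ∎)
      where
      open ≤-Reasoning
      eq : ∀ j → 2 * ((1 + j) * (2 + j * (j + 3))) ≡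
        2 * (1 + j) * (1 + (1 + j)) + (1 + j) * (2 * j * (j + 2))
      eq = solve-∀

  bound-with-big : ∀ {L T M} b′ y x → T < 2 * B → j ≡ 1 + b′ + y → M ≡ 1 + k * (1 + P) + x →
    let b = 1 + b′ in
    4 * L + b * ((2 * k + 1) * (2 * (1 + P))) ≤ (2 * k + 1) * T + b * (4 * M) →
    L ≤ j * (j + M) + (2 * (k * k * k) + k * k + 1)
  bound-with-big {L} {T} {M} b′ y x T<2B j≡ M≡ 4L≤ = *-cancelˡ-≤ 4 (+-cancelʳ-≤ X _ _ (begin
    4 * L + X                        ≤⟨ 4L≤ ⟩
    (2 * k + 1) * T + b * (4 * M)    ≤⟨ +-monoˡ-≤ (b * (4 * M)) (*-monoʳ-≤ (2 * k + 1) (<⇒≤ T<2B)) ⟩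
    (2 * k + 1) * (2 * B) + b * (4 * M)
      ≤⟨ +-monoˡ-≤ (b * (4 * M)) (≤-by {(2 * k + 1) * (2 * B)}
           (2 * b′ * (1 + j * (j + 3)) + 2 * (1 + j) * j * (j + 2) + 6) (eq₂ j b′)) ⟩
    2 * b * (1 + P) + 4 * (j * (k * (1 + P))) + 4 * (j * j) + 4 * R + b * (4 * M)
      ≤⟨ ≤-by (4 * y + 4 * y * x) (subst₂ (λ i M →
           4 * (i * (i + M) + R) + X ≡
           2 * b * (1 + P) + 4 * (i * (k * (1 + P))) + 4 * (i * i) + 4 * R + b * (4 * M) + (4 * y + 4 * y * x))
           (sym j≡) (sym M≡) (eq₁ b y x k (1 + P) R)) ⟩
    4 * (j * (j + M) + R) + X        ∎))
    where
    open ≤-Reasoning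
    b = 1 + b′
    X = b * ((2 * k + 1) * (2 * (1 + P)))
    R = 2 * (k * k * k) + k * k + 1
    eq₁ : ∀ b y x k q r → 4 * ((b + y) * (b + y + (1 + k * q + x)) + r) + b * ((2 * k + 1) * (2 * q)) ≡
      2 * b * q + 4 * ((b + y) * (k * q)) + 4 * ((b + y) * (b + y)) + 4 * r + b * (4 * (1 + k * q + x))
        + (4 * y + 4 * y * x)
    eq₁ = solve-∀
    eq₂ : ∀ j b′ →
      2 * (1 + b′) * (1 + j * (j + 3)) + 4 * (j * ((1 + j) * (1 + j * (j + 3)))) + 4 * (j * j)
        + 4 * (2 * ((1 + j) * (1 + j) * (1 + j)) + (1 + j) * (1 + j) + 1) ≡
      (2 * (1 + j) + 1) * (2 * ((1 + j) * (2 + j * (j + 3))))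
        + (2 * b′ * (1 + j * (j + 3)) + 2 * (1 + j) * j * (j + 2) + 6)
    eq₂ = solve-∀

  j+[1+k[1+P]]≡B : j + (1 + k * (1 + P)) ≡ B
  j+[1+k[1+P]]≡B = eq j P
    where
    eq : ∀ j p → j + (1 + (1 + j) * (1 + p)) ≡ (1 + j) * (2 + p)
    eq = solve-∀

  -- For the chosen vertex, `m` and `b` count the core neighbours and the big ones, `T` is their
  -- total cost and `L` their total excess over `j`.
  degree≤f : ∀ {x L T m D} b → (D < B → b ≡ 0) → T < 2 * B → x ≤ j * D + L →
    4 * L + b * ((2 * k + 1) * (2 * (1 + P))) ≤ (2 * k + 1) * T + b * (4 * (D ∸ j)) →
    2 * k * m + b * (2 * j * (j + 2)) ≤ T →
    L ≤ m * (D ∸ j) →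
    + x ℤ.≤ f (+ k) D
  degree≤f {L = L} {T} {D = D} zero _ T<2B x≤ excess _ _ =
    ≤f-third D (≤-trans x≤ (+-monoʳ-≤ (j * D) (bound-without-big T<2B
      (subst₂ _≤_ (+-identityʳ (4 * L)) (+-identityʳ ((2 * k + 1) * T)) excess))))
  degree≤f {x} {L} {T} {m} {D} (suc b′) D<B⇒b≡0 T<2B x≤ excess core L≤ = by-size (k ≤? suc b′)
    where
    M = D ∸ j
    -- A single big neighbour forces the maximum degree up to `B`, which is what makes `M` large.
    B≤D : B ≤ D
    B≤D = ≮⇒≥ λ D<B → contradiction (D<B⇒b≡0 D<B) λ ()
    D≡j+M : D ≡ j + M
    D≡j+M = sym (m+[n∸m]≡n (≤-trans (≤-trans (m≤m+n j _) (≤-reflexive j+[1+k[1+P]]≡B)) B≤D))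
    M≥ : 1 + k * (1 + P) ≤ M
    M≥ = ≤-trans (≤-reflexive (sym (m+n∸m≡n j _))) (∸-monoˡ-≤ j (≤-trans (≤-reflexive j+[1+k[1+P]]≡B) B≤D))
    by-size : Dec (k ≤ suc b′) → + x ℤ.≤ f (+ k) D
    by-size (yes k≤b) = subst (λ D → + x ℤ.≤ f (+ k) D) (sym D≡j+M) (≤f-first M
      (≤-trans x≤ (+-mono-≤ (*-monoʳ-≤ j (≤-reflexive D≡j+M))
        (≤-trans L≤ (*-monoˡ-≤ M (few-core-neighbours T<2B {m} k≤b core))))))
    by-size (no k≰b) = ≤f-second D (≤-trans x≤ (+-monoʳ-≤ (j * D) (≤-trans
      (bound-with-big b′ (j ∸ suc b′) (M ∸ (1 + k * (1 + P))) T<2B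
        (sym (m+[n∸m]≡n (≤-pred (≰⇒> k≰b)))) (sym (m+[n∸m]≡n M≥)) excess)
      (+-monoˡ-≤ (2 * (k * k * k) + k * k + 1) (*-monoʳ-≤ j (≤-reflexive (sym D≡j+M)))))))

-- A vertex of low degree in the square.

module SparseSquare {n : ℕ} (G : Graph n) (H : Subgraph (sqAdj G)) (j : ℕ) where
  open Summation n
  open Neighbours G H
  open Cost j

  rate big : ℕ → ℕ
  rate e = proj₁ (tier e)
  big e = proj₁ (proj₂ (tier e))

  rate-tier : ∀ e → Tier e (rate e) (big e)
  rate-tier e = proj₂ (proj₂ (tier e))

  open Discharging G H k Q k<Q rate
    (λ {e} → cost≤Q (rate-tier e)) (λ {e} → Q≤cost (rate-tier e)) (λ {e} → cost-charge (rate-tier e)) public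

  -- Every neighbour is allotted `j`. One outside the core has `d w ≤ k` and contributes at most
  -- `k − 1`, so only core neighbours can exceed this.
  square-degree : ∀ v → S v ≡ true →
    degIn (edge H) v ≤ j * Δ G + ∑ (λ w → A v w * γ w * (d w ∸ j))
  square-degree v v∈S = begin
    degIn (edge H) v
      ≤⟨ degree-bound v v∈S ⟩
    ∑ (λ w → A v w * (σ w + y v v∈S w))
      ≤⟨ ∑-mono (λ w → pointwise (adj G v w) (S w) (heavy w) (y<d v v∈S w)
           (λ light → ≮⇒≥ λ k<d → contradiction (trans (sym (Equivalence.to T-≡ (<⇒<ᵇ k<d))) light) λ ())) ⟩
    ∑ (λ w → j * A v w + A v w * γ w * (d w ∸ j))
      ≡⟨ trans (∑-+ _ _) (cong (_+ ∑ (λ w → A v w * γ w * (d w ∸ j))) (∑-*ˡ j (A v))) ⟩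
    j * ∑ (A v) + ∑ (λ w → A v w * γ w * (d w ∸ j))
      ≤⟨ +-monoˡ-≤ _ (*-monoʳ-≤ j (∈⇒≤max (degIn (adj G)) (∈-allFin v))) ⟩
    j * Δ G + ∑ (λ w → A v w * γ w * (d w ∸ j)) ∎
    where
    open ≤-Reasoning
    pointwise : ∀ a s h {y e} → (a ≡ true → y < e) → (h ≡ false → e ≤ suc j) →
      ⟦ a ⟧ * (⟦ s ⟧ + y) ≤ j * ⟦ a ⟧ + ⟦ a ⟧ * ⟦ s ∨ h ⟧ * (e ∸ j)
    pointwise false s h _ _ = z≤n
    pointwise true s h {y} {e} y<e e≤k = begin
      1 * (⟦ s ⟧ + y)                 ≡⟨ *-identityˡ _ ⟩
      ⟦ s ⟧ + y                       ≤⟨ go s h e≤k ⟩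
      j + ⟦ s ∨ h ⟧ * (e ∸ j)         ≡⟨ cong₂ (λ a b → a + b * (e ∸ j)) (sym (*-identityʳ j))
                                                (sym (*-identityˡ ⟦ s ∨ h ⟧)) ⟩
      j * 1 + 1 * ⟦ s ∨ h ⟧ * (e ∸ j) ∎
      where
      e≤ : e ≤ j + 1 * (e ∸ j)
      e≤ = ≤-trans (m≤n+m∸n e j) (≤-reflexive (cong (λ s → j + s) (sym (*-identityˡ (e ∸ j)))))
      go : ∀ s h → (h ≡ false → e ≤ suc j) → ⟦ s ⟧ + y ≤ j + ⟦ s ∨ h ⟧ * (e ∸ j)
      go true  h     _   = ≤-trans (y<e refl) e≤
      go false true  _   = ≤-trans (<⇒≤ (y<e refl)) e≤
      go false false e≤k = ≤-trans (≤-pred (≤-trans (y<e refl) (e≤k refl))) (m≤m+n j 0)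

  module Weighted (a : Fin n → ℕ) where
    E : (Fin n → ℕ) → ℕ
    E g = ∑ λ w → a w * g w

    E-mono : ∀ {g h} → (∀ w → g w ≤ h w) → E g ≤ E h
    E-mono g≤h = ∑-mono λ w → *-monoʳ-≤ (a w) (g≤h w)

    E-linear : ∀ c g h e → E (λ w → c * g w + h w * e) ≡ c * E g + E h * e
    E-linear c g h e = begin
      E (λ w → c * g w + h w * e)
        ≡⟨ ∑-cong (λ w → eq (a w) c (g w) (h w) e) ⟩
      ∑ (λ w → c * (a w * g w) + e * (a w * h w))
        ≡⟨ trans (∑-+ _ _) (cong₂ _+_ (∑-*ˡ c _) (∑-*ˡ e _)) ⟩
      c * E g + e * E h
        ≡⟨ cong (λ s → c * E g + s) (*-comm e (E h)) ⟩
      c * E g + E h * e ∎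
      where
      open ≡-Reasoning
      eq : ∀ a c g h e → a * (c * g + h * e) ≡ c * (a * g) + e * (a * h)
      eq = solve-∀

  low-degree-vertex : twice∣E∣ coreGraph < 2 * k * ∣V∣ coreGraph →
    ∃ λ v → S v ≡ true × + degIn (edge H) v ℤ.≤ f (+ k) (Δ G)
  low-degree-vertex sparse =
    let v , v∈S , cost<2B = cheap-vertex sparse
    in v , v∈S , bound v v∈S cost<2B
    where
    bound : ∀ v → S v ≡ true → ∑ (λ w → A v w * γ w * cost w) < 2 * B →
      + degIn (edge H) v ℤ.≤ f (+ k) (Δ G)
    bound v v∈S cost<2B =
      degree≤f j (E (big ∘ d)) no-big cost<2B (square-degree v v∈S)
        (subst₂ _≤_ (E-linear 4 _ (big ∘ d) _) (E-linear (2 * k + 1) cost (big ∘ d) _)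
          (E-mono λ w → excess≤cost (rate-tier (d w)) (d≤Δ w)))
        (≤-trans (≤-reflexive (sym (E-linear (2 * k) (λ _ → 1) (big ∘ d) _)))
          (E-mono λ w → ≤-trans (+-monoˡ-≤ _ (≤-reflexive (*-identityʳ (2 * k))))
                                (cost-lower-bound (rate-tier (d w)))))
        -- The coefficient 0 makes `E-linear` yield the number of core neighbours times `Δ G ∸ j`.
        (≤-trans (E-mono λ w → ≤-trans (∸-monoˡ-≤ j (d≤Δ w)) (≤-reflexive (sym (*-identityˡ (Δ G ∸ j)))))
                 (≤-reflexive (E-linear 0 (λ _ → 0) (λ _ → 1) (Δ G ∸ j))))
      where
      open Weighted (λ w → A v w * γ w)
      no-big : Δ G < B → E (big ∘ d) ≡ 0
      no-big Δ<B = trans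
        (∑-cong λ w → trans (cong (A v w * γ w *_) (small⇒big≡0 (rate-tier (d w)) (≤-<-trans (d≤Δ w) Δ<B)))
                            (*-zeroʳ (A v w * γ w)))
        (∑-*ˡ 0 (λ _ → 0))

-- Nonpositive `k` and the conclusion.

edgeless : ∀ {n} (G : Graph n) → Subgraph (sqAdj G) → Subgraph (adj G)
edgeless G H = record
  { vert    = vert H
  ; edge    = λ _ _ → false
  ; edgeSym = λ _ _ → refl
  ; edge⊆   = λ _ _ ()
  ; edgeV   = λ _ _ ()
  }

2*negative≤0 : ∀ m x → + 2 ℤ.* -[1+ m ] ℤ.* + x ℤ.≤ + 0
2*negative≤0 m zero    = ℤ.≤-reflexive (ℤ.*-zeroʳ (+ 2 ℤ.* -[1+ m ]))
2*negative≤0 m (suc x) = ℤ.-≤+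

theorem3 : (k : ℤ) (n : ℕ) (G : Graph n) → madLessThan2k G k →
    Degenerate (sqAdj G) (f k (Δ G))
theorem3 (+ suc j) n G mad H (v , v∈H) =
  low-degree-vertex (ℤ.drop‿+<+ (subst (+ twice∣E∣ coreGraph ℤ.<_) (sym (pos³ 2 (suc j) (∣V∣ coreGraph)))
    (mad coreGraph (v , cong (_∨ heavy v) v∈H))))
  where open SparseSquare G H j
-- For `k ≤ 0` the hypothesis fails on any nonempty subgraph. The edges of `H` need not be edges of
-- `G`, so only its vertices are reused.
theorem3 (+ zero) n G mad H nonempty =
  contradiction (mad (edgeless G H) nonempty) λ { (ℤ.+<+ ()) }
theorem3 -[1+ m ] n G mad H nonempty =
  contradiction (ℤ.<-≤-trans (mad (edgeless G H) nonempty) (2*negative≤0 m _)) λ { (ℤ.+<+ ()) }
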